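{- Let $n,m$ be integers with $6 \le n \le m \le 2n-2$ and $m \ne 2n-5$. If $n+m \equiv 1 \pmod 3$, then \[\gamma^{\rm ID}(K_n\times K_m) = \left\lceil \frac{2m+2n}{3}\right\rceil.\]
   Context: For a graph $G$ and vertex $x$, $N[x]$ denotes the closed neighborhood of $x$. A set $C \subseteq V(G)$ is an identifying code (ID code) of $G$ if $C$ is a dominating set of $G$ and $N[x]\cap C \ne N[y]\cap C$ for every pair of distinct vertices $x,y$. $\gamma^{\rm ID}(G)$ is the minimum cardinality of an ID code of $G$. The direct product $G_1\times G_2$ has vertex set $V(G_1)\times V(G_2)$, with $(u_1,u_2)$ adjacent to $(v_1,v_2)$ iff $u_1v_1\in E(G_1)$ and $u_2v_2 \in E(G_2)$. $K_n$ is the complete graph on vertex set $[n]=\{1,\dots,n\}$; thus in $K_n\times K_m$ two vertices are adjacent iff they differ in both coordinates. -}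

module Defs where

open import Data.Fin.Base using (Fin)
open import Data.List.Base using (List; length)
open import Data.List.Membership.Propositional using (_∈_)
open import Data.List.Relation.Unary.Unique.Propositional using (Unique)
open import Data.Nat.Base using (ℕ; _≤_)
open import Data.Product.Base using (_×_; _,_; ∃-syntax)
open import Data.Sum.Base using (_⊎_)
open import Level using (0ℓ)
open import Relation.Binary.Core using (Rel)
open import Relation.Binary.Definitions using (Symmetric; Irreflexive)
open import Relation.Binary.PropositionalEquality using (_≡_; _≢_; refl; ≢-sym)
open import Relation.Nullary.Negation using (¬_)
open import Relation.Unary using (Pred; _∩_; _≐_; Satisfiable)

record Graph : Set₁ where
  field
    Vertex : Set
    Adj    : Rel Vertex 0ℓ
    sym    : Symmetric Adj
    irrefl : Irreflexive _≡_ Adj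

module _ (G : Graph) where
  open Graph G

  N[_] : Vertex → Pred Vertex 0ℓ
  N[ x ] y = y ≡ x ⊎ Adj x y

  IsDominatingSet : Pred Vertex 0ℓ → Set
  IsDominatingSet C = ∀ x → Satisfiable (N[ x ] ∩ C)

  IsIDCode : Pred Vertex 0ℓ → Set
  IsIDCode C =
      IsDominatingSet C
    × (∀ x y → x ≢ y → ¬ ((N[ x ] ∩ C) ≐ (N[ y ] ∩ C)))

  -- A finite set of vertices is given by a duplicate-free list of its
  -- elements; the length of the list is the cardinality of the set.
  IsFiniteIDCode : List Vertex → Set
  IsFiniteIDCode xs = Unique xs × IsIDCode (_∈ xs)

infix 4 γᴵᴰ_≔_

-- γᴵᴰ is a relation because a graph with two vertices having the same
-- closed neighbourhood has no ID code; the value k is unique when it exists.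
γᴵᴰ_≔_ : Graph → ℕ → Set
γᴵᴰ G ≔ k =
    (∃[ xs ] IsFiniteIDCode G xs × length xs ≡ k)
  × (∀ xs → IsFiniteIDCode G xs → k ≤ length xs)

K : ℕ → Graph
K n = record
  { Vertex = Fin n
  ; Adj    = _≢_
  ; sym    = ≢-sym
  ; irrefl = λ x≡y x≢y → x≢y x≡y
  }

infixr 7 _×ᴳ_

_×ᴳ_ : Graph → Graph → Graph
G ×ᴳ H = record
  { Vertex = G.Vertex × H.Vertex
  ; Adj    = λ (u₁ , u₂) (v₁ , v₂) → G.Adj u₁ v₁ × H.Adj u₂ v₂
  ; sym    = λ (p , q) → G.sym p , H.sym q
  ; irrefl = λ { refl (p , _) → G.irrefl refl p }
  }
  where
  module G = Graph G
  module H = Graph H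

module Submission where

{-
View a code as the edge set of a bipartite graph whose vertices are the n rows
and the m columns, called lines.  Separating all vertices of Kₙ × Kₘ means that
at most one row and at most one column is empty and that no two rows and two
columns are closed under adjacency (a block).

Lower bound.  Count leaves and branches (lines of degree at least two).  With
e edges, K isolated edges, q inner edges (edges without a leaf), and D the sum of
q and of all d ∸ 2 over the degrees d,
  3 e + K + 2 (number of empty lines) = 2 (n + m) + D.
A smaller code would have D + 2 ≤ K + 2 (number of empty lines).  As the blocks
formed by two empty lines and an isolated edge, by an empty row and a row with
two leaves (or dually for columns), and by a path with three edges are excluded, this leaves only
n ≤ 5, or n + m ≤ 10, or m = 2n - 5.

Upper bound.  A disjoint union of paths with two edges and one claw, covering
all lines, has the required number of edges.
-}

open import Defs
open import Algebra.Properties.Semiring.Sum using ()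
open import Data.Bool.Base using (Bool; true; false)
open import Data.Fin.Base using (Fin; zero; suc; punchIn; punchOut)
open import Data.Fin.Properties using (_≟_; suc-injective; punchInᵢ≢i; punchIn-punchOut; punchOut-injective)
open import Data.Integer.Base using (+_)
open import Data.List.Base using (List; []; _∷_; length; map)
open import Data.List.Membership.Propositional using (_∈_)
open import Data.List.Membership.Propositional.Properties using (∈-map⁺; ∈-map⁻)
open import Data.List.Properties using (length-map)
open import Data.List.Relation.Unary.All as All using ([]; _∷_)
open import Data.List.Relation.Unary.All.Properties using () renaming (map⁺ to All-map⁺)
open import Data.List.Relation.Unary.AllPairs using ([]; _∷_)
open import Data.List.Relation.Unary.Any using (here; there)
open import Data.List.Relation.Unary.Unique.Propositional using (Unique)
open import Data.List.Relation.Unary.Unique.Propositional.Properties using () renaming (map⁺ to Unique-map⁺)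
open import Data.Nat.Base as ℕ using (ℕ; zero; suc; _≤_; _<_; _+_; _*_; _∸_; _%_; z≤n; s≤s; z<s)
open import Data.Nat.DivMod using (m≡m%n+[m/n]*n; [m+kn]%n≡m%n; +-distrib-/-∣ʳ; m*n/n≡m)
open import Data.Nat.Divisibility using (n∣m*n)
open import Data.Nat.Properties hiding (_≟_; suc-injective)
open import Data.Nat.Tactic.RingSolver using (solve-∀)
open import Data.Product.Base using (_×_; _,_; ∃-syntax; proj₁; proj₂; swap)
open import Data.Product.Properties using (≡-dec)
open import Data.Rational.Unnormalised.Base using (_/_; ceiling)
open import Data.Sum.Base as Sum using (_⊎_; inj₁; inj₂)
open import Data.Vec.Functional using (removeAt)
open import Function.Base using (_∘_; flip; case_of_)
open import Function.Definitions using (Injective)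
open import Level using (0ℓ)
open import Relation.Binary.Core using (REL)
open import Relation.Binary.PropositionalEquality
open import Relation.Nullary.Decidable.Core using (Dec; yes; no; does; decidable-stable)
open import Relation.Nullary.Negation using (¬_; contradiction)
open import Relation.Unary using (_≐_; _∩_)
import Data.List.Membership.DecPropositional as DecMembership

open Algebra.Properties.Semiring.Sum +-*-semiring
  using (sum; sum-syntax; sum-cong-≗; sum-remove; ∑-distrib-+; ∑-comm; *-distribʳ-sum)

private variable
  n m : ℕ

-- Sums over Fin n

∑-zero : (g : Fin n → ℕ) → (∀ i → g i ≡ 0) → sum g ≡ 0
∑-zero {zero}  g g≡0 = refl
∑-zero {suc n} g g≡0 = cong₂ _+_ (g≡0 zero) (∑-zero (g ∘ suc) (g≡0 ∘ suc))

∑-mono : {g h : Fin n → ℕ} → (∀ i → g i ≤ h i) → sum g ≤ sum h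
∑-mono {zero}  g≤h = z≤n
∑-mono {suc n} g≤h = +-mono-≤ (g≤h zero) (∑-mono (g≤h ∘ suc))

∑-one : ∀ n → ∑[ i < n ] 1 ≡ n
∑-one zero    = refl
∑-one (suc n) = cong suc (∑-one n)

∑-positive : (g : Fin n → ℕ) → 0 < sum g → ∃[ i ] 0 < g i
∑-positive {suc n} g 0<∑ with g zero in eq
... | suc _ = zero , subst (0 <_) (sym eq) z<s
... | zero  with i , 0<gi ← ∑-positive (g ∘ suc) 0<∑ = suc i , 0<gi

term≤∑ : (g : Fin n → ℕ) → ∀ i → g i ≤ sum g
term≤∑ {suc n} g i = subst (g i ≤_) (sym (sum-remove {i = i} g)) (m≤m+n _ _)

-- The witness l is the sum of the terms other than g i and g k.
term+ : (g : Fin n → ℕ) → ∀ {i k} → i ≢ k →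
        ∃[ l ] g i + g k + l ≡ sum g × (∀ {j} → j ≢ i → j ≢ k → g j ≤ l)
term+ {suc zero} g {zero} {zero} i≢k = contradiction refl i≢k
term+ {suc (suc n)} g {i} {k} i≢k = sum (removeAt (removeAt g i) k′) , eq , bound
  where
  k′ = punchOut i≢k
  eq : g i + g k + sum (removeAt (removeAt g i) k′) ≡ sum g
  eq = begin
    g i + g k + sum (removeAt (removeAt g i) k′)    ≡⟨ +-assoc (g i) _ _ ⟩
    g i + (g k + sum (removeAt (removeAt g i) k′))  ≡⟨ cong (λ x → g i + (g x + sum (removeAt (removeAt g i) k′))) (punchIn-punchOut i≢k) ⟨
    g i + (removeAt g i k′ + sum (removeAt (removeAt g i) k′)) ≡⟨ cong (λ z → g i + z) (sum-remove {i = k′} (removeAt g i)) ⟨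
    g i + sum (removeAt g i)                        ≡⟨ sum-remove {i = i} g ⟨
    sum g ∎
    where open ≡-Reasoning
  bound : ∀ {j} → j ≢ i → j ≢ k → g j ≤ sum (removeAt (removeAt g i) k′)
  bound {j} j≢i j≢k = subst (_≤ sum (removeAt (removeAt g i) k′)) (cong g position)
                       (term≤∑ (removeAt (removeAt g i) k′) j″)
    where
    i≢j = j≢i ∘ sym
    j′ = punchOut i≢j
    k′≢j′ : k′ ≢ j′
    k′≢j′ e = j≢k (sym (punchOut-injective i≢k i≢j e))
    j″ = punchOut k′≢j′
    position : punchIn i (punchIn k′ j″) ≡ j
    position = trans (cong (punchIn i) (punchIn-punchOut k′≢j′)) (punchIn-punchOut i≢j)

∑≤1 : (g : Fin n → ℕ) → (∀ i → g i ≤ 1) →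
      (∀ {i k} → 0 < g i → 0 < g k → i ≡ k) → sum g ≤ 1
∑≤1 {zero}  g g≤1 unique = z≤n
∑≤1 {suc n} g g≤1 unique with g zero in eq | g≤1 zero
... | zero  | _     = ∑≤1 (g ∘ suc) (g≤1 ∘ suc) (λ p q → suc-injective (unique p q))
... | suc .0 | s≤s z≤n = s≤s (≤-reflexive (∑-zero (g ∘ suc) rest))
  where
  rest : ∀ i → g (suc i) ≡ 0
  rest i with g (suc i) in eq′
  ... | zero  = refl
  ... | suc _ = case unique (subst (0 <_) (sym eq) z<s) (subst (0 <_) (sym eq′) z<s) of λ ()

-- Uniqueness in the second index bounds each inner sum, and uniqueness in the first leaves at most
-- one of them positive. This serves both isolated edges and the position of a single list element.
∑∑≤1 : (g : Fin n → Fin m → ℕ) → (∀ i j → g i j ≤ 1) →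
       (∀ {i j k l} → 0 < g i j → 0 < g k l → i ≡ k × j ≡ l) →
       ∑[ i < n ] ∑[ j < m ] g i j ≤ 1
∑∑≤1 g g≤1 unique = ∑≤1 (λ i → sum (g i))
  (λ i → ∑≤1 (g i) (g≤1 i) (λ p q → proj₂ (unique p q)))
  (λ {i} {k} p q → proj₁ (unique (proj₂ (∑-positive (g i) p)) (proj₂ (∑-positive (g k) q))))

-- Degrees

⟦_⟧ : Bool → ℕ
⟦ false ⟧ = 0
⟦ true  ⟧ = 1

⟦⟧≤1 : ∀ b → ⟦ b ⟧ ≤ 1
⟦⟧≤1 false = z≤n
⟦⟧≤1 true  = s≤s z≤n

⟦⟧-positive : ∀ {b} → 0 < ⟦ b ⟧ → b ≡ true
⟦⟧-positive {true} _ = refl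

degree : (Fin n → Bool) → ℕ
degree v = sum (⟦_⟧ ∘ v)

Within : (Fin n → Bool) → Fin n → Fin n → Set
Within v j k = ∀ r → v r ≡ true → r ≡ j ⊎ r ≡ k

module _ (v : Fin n → Bool) where

  true⇒degree>0 : ∀ {j} → v j ≡ true → 0 < degree v
  true⇒degree>0 {j} vj = ≤-trans (≤-reflexive (cong ⟦_⟧ (sym vj))) (term≤∑ (⟦_⟧ ∘ v) j)

  degree>0⇒true : 0 < degree v → ∃[ j ] v j ≡ true
  degree>0⇒true 0<d with j , p ← ∑-positive (⟦_⟧ ∘ v) 0<d = j , ⟦⟧-positive p

  degree≡0⇒false : degree v ≡ 0 → ∀ j → v j ≢ true
  degree≡0⇒false d≡0 j vj = <-irrefl (sym d≡0) (true⇒degree>0 vj)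

  degree≡1⇒unique : degree v ≡ 1 → ∀ {j k} → v j ≡ true → v k ≡ true → j ≡ k
  degree≡1⇒unique d≡1 {j} {k} vj vk with j ≟ k
  ... | yes j≡k = j≡k
  ... | no j≢k with l , eq , _ ← term+ (⟦_⟧ ∘ v) j≢k rewrite vj | vk
    = case trans eq d≡1 of λ ()

  -- The only neighbour is `j`, so the second position `k` is free; blocks use this to pair a leaf
  -- with any further line.
  degree≡1⇒within : degree v ≡ 1 → ∀ {j k} → v j ≡ true → Within v j k
  degree≡1⇒within d≡1 vj r vr = inj₁ (degree≡1⇒unique d≡1 vr vj)

  degree≡2⇒within : degree v ≡ 2 → ∀ {j k} → j ≢ k → v j ≡ true → v k ≡ true → Within v j k
  degree≡2⇒within d≡2 {j} {k} j≢k vj vk r vr with r ≟ j | r ≟ k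
  ... | yes r≡j | _       = inj₁ r≡j
  ... | no _    | yes r≡k = inj₂ r≡k
  ... | no r≢j  | no r≢k with l , eq , bound ← term+ (⟦_⟧ ∘ v) j≢k rewrite vj | vk
    with s≤s _ ← subst (_≤ l) (cong ⟦_⟧ vr) (bound r≢j r≢k) = case trans eq d≡2 of λ ()

degree≥2⇒other : (v : Fin n → Bool) → 2 ≤ degree v → ∀ j → ∃[ k ] j ≢ k × v k ≡ true
degree≥2⇒other {suc n} v 2≤d j = punchIn j k , punchInᵢ≢i j k ∘ sym , vk
  where
  rest : 1 ≤ degree (removeAt v j)
  rest = ≤-pred (≤-trans (subst (2 ≤_) (sum-remove {i = j} (⟦_⟧ ∘ v)) 2≤d)
                        (+-monoˡ-≤ _ (⟦⟧≤1 (v j))))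
  k = proj₁ (degree>0⇒true (removeAt v j) rest)
  vk = proj₂ (degree>0⇒true (removeAt v j) rest)

isEmpty isLeaf isBranch : ℕ → ℕ
isEmpty zero    = 1
isEmpty (suc _) = 0
isLeaf 1 = 1
isLeaf _ = 0
isBranch (suc (suc _)) = 1
isBranch _ = 0

isLeaf≤1 : ∀ d → isLeaf d ≤ 1
isLeaf≤1 0             = z≤n
isLeaf≤1 1             = ≤-refl
isLeaf≤1 (suc (suc _)) = z≤n

isLeaf-positive : ∀ d → 0 < isLeaf d → d ≡ 1
isLeaf-positive 1 _ = refl

isBranch-positive : ∀ d → 0 < isBranch d → 2 ≤ d
isBranch-positive (suc (suc _)) _ = s≤s (s≤s z≤n)

isBranch≡1 : ∀ {d} → 2 ≤ d → isBranch d ≡ 1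
isBranch≡1 (s≤s (s≤s _)) = refl

degree-trichotomy : ∀ d → 1 ≡ isEmpty d + (isLeaf d + isBranch d)
degree-trichotomy 0             = refl
degree-trichotomy 1             = refl
degree-trichotomy (suc (suc _)) = refl

-- A branch is charged two edges and its surplus is `d ∸ 2`; truncation makes the surplus vanish on
-- empty lines and leaves.
degree-decomposition : ∀ d → d ≡ isLeaf d + isBranch d + isBranch d + (d ∸ 2)
degree-decomposition 0             = refl
degree-decomposition 1             = refl
degree-decomposition (suc (suc _)) = refl

-- A degree above two pays for the branch through `d ∸ 2` alone, so only degree exactly two draws on
-- `s`, later the number of inner edges at the row.
isBranch≤ : ∀ d s → (d ≡ 2 → 0 < s) → isBranch d ≤ (d ∸ 2) + s
isBranch≤ 0 s _ = z≤n
isBranch≤ 1 s _ = z≤n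
isBranch≤ 2 s h = h refl
isBranch≤ (suc (suc (suc d))) s h = s≤s z≤n

-- Counting the lines and edges of a bipartite graph

Matrix : ℕ → ℕ → Set
Matrix n m = Fin n → Fin m → Bool

∑ᵉ : Matrix n m → (Fin n → Fin m → ℕ) → ℕ
∑ᵉ {n} {m} f w = ∑[ i < n ] ∑[ j < m ] (⟦ f i j ⟧ * w i j)

edge-positive : ∀ {b} u v → 0 < ⟦ b ⟧ * (u * v) → b ≡ true × 0 < u × 0 < v
edge-positive {true} (suc u) (suc v) _ = refl , z<s , z<s
edge-positive {true} (suc u) zero p rewrite *-zeroʳ u = case p of λ ()

∑ᵉ-flip : (f : Matrix n m) (w : Fin n → Fin m → ℕ) → ∑ᵉ (flip f) (flip w) ≡ ∑ᵉ f w
∑ᵉ-flip f w = ∑-comm (λ j i → ⟦ f i j ⟧ * w i j)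

module _ (f : Matrix n m) where

  row : Fin n → ℕ
  row i = degree (f i)

  col : Fin m → ℕ
  col j = degree (flip f j)

  innerEdge isolatedEdge : Fin n → Fin m → ℕ
  innerEdge    i j = ⟦ f i j ⟧ * (isBranch (row i) * isBranch (col j))
  isolatedEdge i j = ⟦ f i j ⟧ * (isLeaf (row i) * isLeaf (col j))

  edges empties leaves branches excess inner isolated : ℕ
  edges    = ∑[ i < n ] row i
  empties  = ∑[ i < n ] isEmpty (row i)
  leaves   = ∑[ i < n ] isLeaf (row i)
  branches = ∑[ i < n ] isBranch (row i)
  excess   = ∑[ i < n ] (row i ∸ 2)
  inner    = ∑[ i < n ] sum (innerEdge i)
  isolated = ∑[ i < n ] sum (isolatedEdge i)

  row-count : n ≡ empties + (leaves + branches)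
  row-count = begin
    n ≡⟨ ∑-one n ⟨
    ∑[ i < n ] 1 ≡⟨ sum-cong-≗ (degree-trichotomy ∘ row) ⟩
    ∑[ i < n ] (isEmpty (row i) + (isLeaf (row i) + isBranch (row i)))
      ≡⟨ ∑-distrib-+ (isEmpty ∘ row) _ ⟩
    empties + ∑[ i < n ] (isLeaf (row i) + isBranch (row i))
      ≡⟨ cong (λ z → empties + z) (∑-distrib-+ (isLeaf ∘ row) _) ⟩
    empties + (leaves + branches) ∎
    where open ≡-Reasoning

  edge-count : edges ≡ leaves + branches + branches + excess
  edge-count = begin
    edges ≡⟨ sum-cong-≗ (degree-decomposition ∘ row) ⟩
    ∑[ i < n ] (isLeaf (row i) + isBranch (row i) + isBranch (row i) + (row i ∸ 2))
      ≡⟨ ∑-distrib-+ (λ i → isLeaf (row i) + isBranch (row i) + isBranch (row i)) _ ⟩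
    ∑[ i < n ] (isLeaf (row i) + isBranch (row i) + isBranch (row i)) + excess
      ≡⟨ cong (_+ excess) (∑-distrib-+ (λ i → isLeaf (row i) + isBranch (row i)) _) ⟩
    ∑[ i < n ] (isLeaf (row i) + isBranch (row i)) + branches + excess
      ≡⟨ cong (λ x → x + branches + excess) (∑-distrib-+ (isLeaf ∘ row) _) ⟩
    leaves + branches + branches + excess ∎
    where open ≡-Reasoning

  ∑ᵉ-row : (w : ℕ → ℕ) → ∑ᵉ f (λ i j → w (row i)) ≡ ∑[ i < n ] (row i * w (row i))
  ∑ᵉ-row w = sum-cong-≗ (λ i → sym (*-distribʳ-sum (w (row i)) (⟦_⟧ ∘ f i)))

  -- A sum over edges counts a row once per edge, hence a leaf exactly once.
  leaves-by-edges : ∑ᵉ f (λ i j → isLeaf (row i)) ≡ leaves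
  leaves-by-edges = trans (∑ᵉ-row isLeaf) (sum-cong-≗ (d*isLeaf ∘ row))
    where
    d*isLeaf : ∀ d → d * isLeaf d ≡ isLeaf d
    d*isLeaf 0 = refl
    d*isLeaf 1 = refl
    d*isLeaf (suc (suc d)) = *-zeroʳ d

  edges-flip : edges ≡ ∑[ j < m ] col j
  edges-flip = ∑-comm (λ i j → ⟦ f i j ⟧)

  innerEdge≡1 : ∀ {i j} → f i j ≡ true → 2 ≤ row i → 2 ≤ col j → innerEdge i j ≡ 1
  innerEdge≡1 fij ri cj rewrite fij | isBranch≡1 ri | isBranch≡1 cj = refl

  edges⇒row : ∀ {i j} → f i j ≡ true → 0 < row i
  edges⇒row = true⇒degree>0 (f _)

  edges⇒col : ∀ {i j} → f i j ≡ true → 0 < col j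
  edges⇒col = true⇒degree>0 (flip f _)

∑ᵉ-+ : (f : Matrix n m) (v w : Fin n → Fin m → ℕ) →
       ∑ᵉ f (λ i j → v i j + w i j) ≡ ∑ᵉ f v + ∑ᵉ f w
∑ᵉ-+ {n} {m} f v w = begin
  ∑[ i < n ] ∑[ j < m ] (⟦ f i j ⟧ * (v i j + w i j))
    ≡⟨ sum-cong-≗ (λ i → trans (sum-cong-≗ (λ j → *-distribˡ-+ ⟦ f i j ⟧ (v i j) (w i j)))
                               (∑-distrib-+ (λ j → ⟦ f i j ⟧ * v i j) _)) ⟩
  ∑[ i < n ] (∑[ j < m ] (⟦ f i j ⟧ * v i j) + ∑[ j < m ] (⟦ f i j ⟧ * w i j))
    ≡⟨ ∑-distrib-+ (λ i → ∑[ j < m ] (⟦ f i j ⟧ * v i j)) _ ⟩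
  ∑ᵉ f v + ∑ᵉ f w ∎
  where open ≡-Reasoning

∑ᵉ-cong : (f : Matrix n m) {v w : Fin n → Fin m → ℕ} →
          (∀ {i j} → f i j ≡ true → v i j ≡ w i j) → ∑ᵉ f v ≡ ∑ᵉ f w
∑ᵉ-cong f {v} {w} v≡w = sum-cong-≗ (λ i → sum-cong-≗ (eq i))
  where
  eq : ∀ i j → ⟦ f i j ⟧ * v i j ≡ ⟦ f i j ⟧ * w i j
  eq i j with f i j in fij
  ... | false = refl
  ... | true  = cong (_+ 0) (v≡w fij)

module _ (f : Matrix n m) where

  inner-flip : inner (flip f) ≡ inner f
  inner-flip = trans (∑ᵉ-cong (flip f) (λ {j} {i} _ → *-comm (isBranch (col f j)) _))
                     (∑ᵉ-flip f (λ i j → isBranch (row f i) * isBranch (col f j)))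

  -- An isolated edge has two leaf ends, an inner edge none, and any other edge exactly one. Summed
  -- over all edges, each leaf line is counted once.
  leaf-count : edges f + isolated f ≡ leaves f + leaves (flip f) + inner f
  leaf-count = begin
    edges f + isolated f
      ≡⟨ cong (_+ isolated f) (sum-cong-≗ (λ i → sum-cong-≗ (λ j → *-identityʳ ⟦ f i j ⟧))) ⟨
    ∑ᵉ f (λ _ _ → 1) + isolated f
      ≡⟨ ∑ᵉ-+ f _ _ ⟨
    ∑ᵉ f (λ i j → 1 + L i * L′ j)
      ≡⟨ ∑ᵉ-cong f (λ fij → ends _ _ (edges⇒row f fij) (edges⇒col f fij)) ⟩
    ∑ᵉ f (λ i j → L i + L′ j + B i * B′ j)
      ≡⟨ ∑ᵉ-+ f _ _ ⟩
    ∑ᵉ f (λ i j → L i + L′ j) + inner f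
      ≡⟨ cong (_+ inner f) (∑ᵉ-+ f _ _) ⟩
    ∑ᵉ f (λ i j → L i) + ∑ᵉ f (λ i j → L′ j) + inner f
      ≡⟨ cong (λ x → x + ∑ᵉ f (λ i j → L′ j) + inner f) (leaves-by-edges f) ⟩
    leaves f + ∑ᵉ f (λ i j → L′ j) + inner f
      ≡⟨ cong (λ x → leaves f + x + inner f) (trans (sym (∑ᵉ-flip f (λ i j → L′ j))) (leaves-by-edges (flip f))) ⟩
    leaves f + leaves (flip f) + inner f ∎
    where
    open ≡-Reasoning
    L  = isLeaf ∘ row f
    L′ = isLeaf ∘ col f
    B  = isBranch ∘ row f
    B′ = isBranch ∘ col f
    ends : ∀ c d → 0 < c → 0 < d →
           1 + isLeaf c * isLeaf d ≡ isLeaf c + isLeaf d + isBranch c * isBranch d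
    ends 1             1             _ _ = refl
    ends 1             (suc (suc _)) _ _ = refl
    ends (suc (suc _)) 1             _ _ = refl
    ends (suc (suc _)) (suc (suc _)) _ _ = refl

  branches≡0⇒excess≡0 : branches f ≡ 0 → excess f ≡ 0
  branches≡0⇒excess≡0 b≡0 = ∑-zero _ (λ i → no-branch (row f i) (n≤0⇒n≡0 (subst (isBranch (row f i) ≤_) b≡0 (term≤∑ (isBranch ∘ row f) i))))
    where
    no-branch : ∀ d → isBranch d ≡ 0 → d ∸ 2 ≡ 0
    no-branch 0 _ = refl
    no-branch 1 _ = refl

  empty-row : 0 < empties f → ∃[ i ] ∀ j → f i j ≢ true
  empty-row p with i , q ← ∑-positive (isEmpty ∘ row f) p with row f i in eq
  ... | zero = i , degree≡0⇒false (f i) eq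

-- Separation and the excluded blocks

-- If every edge meeting one of the lines i, k, j, l is among these four lines,
-- then (i , j) and (k , l) have the same closed neighbourhood in the code.
Block : Matrix n m → Fin n → Fin n → Fin m → Fin m → Set
Block f i k j l = (Within (f i) j l × Within (f k) j l)
                × (Within (flip f j) i k × Within (flip f l) i k)

record Separated (f : Matrix n m) : Set where
  field
    empty-row-unique : ∀ {i k} → (∀ j → f i j ≢ true) → (∀ j → f k j ≢ true) → i ≡ k
    empty-col-unique : ∀ {j l} → (∀ i → f i j ≢ true) → (∀ i → f i l ≢ true) → j ≡ l
    no-block         : ∀ {i k j l} → i ≢ k → j ≢ l → ¬ Block f i k j l

open Separated

flip-separated : {f : Matrix n m} → Separated f → Separated (flip f)
flip-separated s .empty-row-unique = empty-col-unique s
flip-separated s .empty-col-unique = empty-row-unique s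
flip-separated s .no-block i≢k j≢l (rows , cols) = no-block s j≢l i≢k (cols , rows)

module _ {f : Matrix n m} (s : Separated f) where

  empties≤1 : empties f ≤ 1
  empties≤1 = ∑≤1 (isEmpty ∘ row f) (isEmpty≤1 ∘ row f) (λ p q → empty-row-unique s (empty _ p) (empty _ q))
    where
    isEmpty≤1 : ∀ d → isEmpty d ≤ 1
    isEmpty≤1 zero    = s≤s z≤n
    isEmpty≤1 (suc d) = z≤n
    empty : ∀ i → 0 < isEmpty (row f i) → ∀ j → f i j ≢ true
    empty i p with row f i in eq
    ... | zero = degree≡0⇒false (f i) eq

  -- Two different isolated edges share no line, so their four lines form a block.
  isolated≤1 : isolated f ≤ 1
  isolated≤1 = ∑∑≤1 (isolatedEdge f)
    (λ i j → *-mono-≤ (⟦⟧≤1 (f i j)) (*-mono-≤ (isLeaf≤1 (row f i)) (isLeaf≤1 (col f j)))) unique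
    where
    unique : ∀ {i j k l} → 0 < isolatedEdge f i j → 0 < isolatedEdge f k l → i ≡ k × j ≡ l
    unique {i} {j} {k} {l} p q
      with fij , ri , cj ← edge-positive _ _ p | fkl , rk , cl ← edge-positive _ _ q
      with i ≟ k | j ≟ l
    ... | yes refl | _ = refl , degree≡1⇒unique (f i) (isLeaf-positive _ ri) fij fkl
    ... | no _ | yes refl = degree≡1⇒unique (flip f j) (isLeaf-positive _ cj) fij fkl , refl
    ... | no i≢k | no j≢l = contradiction
      ( (degree≡1⇒within (f i) (isLeaf-positive _ ri) fij
        , λ r → Sum.swap ∘ degree≡1⇒within (f k) (isLeaf-positive _ rk) fkl r)
      , (degree≡1⇒within (flip f j) (isLeaf-positive _ cj) fij
        , λ r → Sum.swap ∘ degree≡1⇒within (flip f l) (isLeaf-positive _ cl) fkl r))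
      (no-block s i≢k j≢l)

  -- The two empty lines and the two ends of an isolated edge meet no further edge, so they form a
  -- block.
  not-all-degenerate : 0 < empties f → 0 < empties (flip f) → isolated f ≡ 0
  not-all-degenerate er ec with isolated f in eq
  ... | zero  = refl
  ... | suc _
    with k , fk ← empty-row f er | l , fl ← empty-row (flip f) ec
    with i , p ← ∑-positive (sum ∘ isolatedEdge f) (subst (0 <_) (sym eq) z<s)
    with j , q ← ∑-positive (isolatedEdge f i) p
    with fij , ri , cj ← edge-positive _ _ q = contradiction
      ( (degree≡1⇒within (f i) (isLeaf-positive _ ri) fij , λ r fkr → contradiction fkr (fk r))
      , (degree≡1⇒within (flip f j) (isLeaf-positive _ cj) fij , λ r frl → contradiction frl (fl r)))
      (no-block s (λ { refl → fk j fij }) (λ { refl → fl i fij }))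

  -- A row with exactly two neighbours, both of them leaves, would form a
  -- block together with an empty row.
  branches≤ : 0 < empties f → branches f ≤ excess f + inner f
  branches≤ p with k , fk ← empty-row f p =
    subst (branches f ≤_) (∑-distrib-+ (λ i → row f i ∸ 2) _)
      (∑-mono (λ i → isBranch≤ (row f i) _ (two i)))
    where
    inner-edge : ∀ {i j} → f i j ≡ true → 2 ≤ row f i → 2 ≤ col f j → 0 < sum (innerEdge f i)
    inner-edge {i} {j} fij ri cj =
      subst (_≤ sum (innerEdge f i)) (innerEdge≡1 f fij ri cj) (term≤∑ (innerEdge f i) j)
    two : ∀ i → row f i ≡ 2 → 0 < sum (innerEdge f i)
    two i ri
      with j , fij ← degree>0⇒true (f i) (subst (0 <_) (sym ri) z<s)
      with l , j≢l , fil ← degree≥2⇒other (f i) (≤-reflexive (sym ri)) j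
      with 2 ≤? col f j | 2 ≤? col f l
    ... | yes cj | _ = inner-edge fij (≤-reflexive (sym ri)) cj
    ... | no _ | yes cl = inner-edge fil (≤-reflexive (sym ri)) cl
    ... | no cj | no cl = contradiction
      ( (degree≡2⇒within (f i) ri j≢l fij fil , λ r fkr → contradiction fkr (fk r))
      , (degree≡1⇒within (flip f j) (≤-antisym (≤-pred (≰⇒> cj)) (edges⇒col f fij)) fij
        , degree≡1⇒within (flip f l) (≤-antisym (≤-pred (≰⇒> cl)) (edges⇒col f fil)) fil))
      (no-block s (λ { refl → fk j fij }) j≢l)

-- Without excess, row `i` has degree two. Its second neighbour `l` is a leaf, as otherwise
-- `(i , j)` and `(i , l)` would be two inner edges.
leaf-partner : (f : Matrix n m) → excess f ≡ 0 → inner f ≡ 1 →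
               ∀ {i j} → f i j ≡ true → 2 ≤ row f i → 2 ≤ col f j →
               ∃[ l ] j ≢ l × Within (f i) j l × (∀ k → Within (flip f l) i k)
leaf-partner {m = m} f x≡0 q≡1 {i} {j} fij ri cj
  with l , j≢l , fil ← degree≥2⇒other (f i) ri j
  with 2 ≤? col f l
... | no cl = l , j≢l
  , degree≡2⇒within (f i) (≤-antisym (m∸n≡0⇒m≤n (n≤0⇒n≡0 (subst (row f i ∸ 2 ≤_) x≡0 (term≤∑ (λ k → row f k ∸ 2) i)))) ri) j≢l fij fil
  , λ k → degree≡1⇒within (flip f l) (≤-antisym (≤-pred (≰⇒> cl)) (edges⇒col f fil)) fil
... | yes cl = contradiction (≤-trans two≤ (≤-trans (term≤∑ (sum ∘ innerEdge f) i) (≤-reflexive q≡1))) λ { (s≤s ()) }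
  where
  two≤ : 2 ≤ sum (innerEdge f i)
  two≤ with x , eq , _ ← term+ (innerEdge f i) j≢l = begin
    2                                     ≡⟨ cong₂ _+_ (innerEdge≡1 f fij ri cj) (innerEdge≡1 f fil ri cl) ⟨
    innerEdge f i j + innerEdge f i l     ≤⟨ m≤m+n _ x ⟩
    innerEdge f i j + innerEdge f i l + x ≡⟨ eq ⟩
    sum (innerEdge f i)                   ∎
    where open ≤-Reasoning

-- Without excess, a single inner edge is the middle edge of a path component
-- with three edges, which is a block.
no-path : {f : Matrix n m} → Separated f → excess f ≡ 0 → excess (flip f) ≡ 0 → inner f ≢ 1
no-path {f = f} s x≡0 x′≡0 q≡1
  with i , p ← ∑-positive (sum ∘ innerEdge f) (≤-reflexive (sym q≡1))
  with j , q ← ∑-positive (innerEdge f i) p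
  with fij , ri , cj ← edge-positive _ _ q
  with l , j≢l , fi , fl ← leaf-partner f x≡0 q≡1 fij (isBranch-positive _ ri) (isBranch-positive _ cj)
  -- The transposed matrix supplies the other end of the path.
  with k , i≢k , fj , fk ← leaf-partner (flip f) x′≡0 (trans (inner-flip f) q≡1) fij
                             (isBranch-positive _ cj) (isBranch-positive _ ri)
  = no-block s i≢k j≢l ((fi , fk l) , (fj , fl k))

-- Arithmetic of the line counts

-- Stated for plain numbers, so that the ring solver applies and the transposed graph is another
-- instance: `r₀ r₁ r₂` count empty, leaf and branch rows, `c₀ c₁ c₂` the same for columns, `x` and
-- `y` are the row and column excess, `q` counts inner and `k` isolated edges.
module LineCounts {n m e r₀ r₁ r₂ c₀ c₁ c₂ x y q k : ℕ}
  (n≡ : n ≡ r₀ + (r₁ + r₂)) (m≡ : m ≡ c₀ + (c₁ + c₂))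
  (e≡r : e ≡ r₁ + r₂ + r₂ + x) (e≡c : e ≡ c₁ + c₂ + c₂ + y)
  (e+k≡ : e + k ≡ r₁ + c₁ + q)
  where

  -- The edges are counted three times: by rows, by columns and by their ends. In the total every
  -- leaf and every branch line has weight two, and the empty lines are added with the same weight.
  weight : 3 * e + (k + 2 * (r₀ + c₀)) ≡ 2 * (n + m) + (x + y + q)
  weight = begin
    3 * e + (k + 2 * (r₀ + c₀))             ≡⟨ regroup e k r₀ c₀ ⟩
    e + e + (e + k) + 2 * (r₀ + c₀)         ≡⟨ cong (_+ 2 * (r₀ + c₀)) (cong₂ _+_ (cong₂ _+_ e≡r e≡c) e+k≡) ⟩
    (r₁ + r₂ + r₂ + x) + (c₁ + c₂ + c₂ + y) + (r₁ + c₁ + q) + 2 * (r₀ + c₀)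
                                            ≡⟨ collect r₀ r₁ r₂ c₀ c₁ c₂ x y q ⟩
    2 * (r₀ + (r₁ + r₂) + (c₀ + (c₁ + c₂))) + (x + y + q)
                                            ≡⟨ cong₂ (λ a b → 2 * (a + b) + (x + y + q)) n≡ m≡ ⟨
    2 * (n + m) + (x + y + q) ∎
    where
    open ≡-Reasoning
    regroup : ∀ e k r₀ c₀ → 3 * e + (k + 2 * (r₀ + c₀)) ≡ e + e + (e + k) + 2 * (r₀ + c₀)
    regroup = solve-∀
    collect : ∀ r₀ r₁ r₂ c₀ c₁ c₂ x y q →
      (r₁ + r₂ + r₂ + x) + (c₁ + c₂ + c₂ + y) + (r₁ + c₁ + q) + 2 * (r₀ + c₀)
      ≡ 2 * (r₀ + (r₁ + r₂) + (c₀ + (c₁ + c₂))) + (x + y + q)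
    collect = solve-∀

  -- Equating the count by columns with the count by ends eliminates `e` and `c₁`.
  leaf-rows : r₁ + q ≡ c₂ + c₂ + y + k
  leaf-rows = +-cancelˡ-≡ c₁ _ _ (begin
    c₁ + (r₁ + q)                ≡⟨ regroup r₁ c₁ q ⟩
    r₁ + c₁ + q                  ≡⟨ e+k≡ ⟨
    e + k                        ≡⟨ cong (_+ k) e≡c ⟩
    c₁ + c₂ + c₂ + y + k         ≡⟨ regroup′ c₁ c₂ y k ⟩
    c₁ + (c₂ + c₂ + y + k)       ∎)
    where
    open ≡-Reasoning
    regroup : ∀ r₁ c₁ q → c₁ + (r₁ + q) ≡ r₁ + c₁ + q
    regroup = solve-∀
    regroup′ : ∀ c₁ c₂ y k → c₁ + c₂ + c₂ + y + k ≡ c₁ + (c₂ + c₂ + y + k)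
    regroup′ = solve-∀

  -- Once `r₁` is eliminated too, `n` depends on the branch counts and on quantities that are small
  -- when there are too few edges.
  row-total : n + q ≡ r₀ + (c₂ + c₂ + y + k) + r₂
  row-total = begin
    n + q                        ≡⟨ cong (_+ q) n≡ ⟩
    r₀ + (r₁ + r₂) + q           ≡⟨ regroup r₀ r₁ r₂ q ⟩
    r₀ + (r₁ + q) + r₂           ≡⟨ cong (λ z → r₀ + z + r₂) leaf-rows ⟩
    r₀ + (c₂ + c₂ + y + k) + r₂  ∎
    where
    open ≡-Reasoning
    regroup : ∀ r₀ r₁ r₂ q → r₀ + (r₁ + r₂) + q ≡ r₀ + (r₁ + q) + r₂
    regroup = solve-∀

-- `light` is what `weight` leaves when there are too few edges; the lemmas treat the four possible
-- pairs `(r₀ , c₀)`.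
module Light {n m r₀ c₀ r₂ c₂ x y q k : ℕ}
  (rows : n + q ≡ r₀ + (c₂ + c₂ + y + k) + r₂)
  (cols : m + q ≡ c₀ + (r₂ + r₂ + x + k) + c₂)
  (light : x + y + q + 2 ≤ k + 2 * (r₀ + c₀))
  (k≤1 : k ≤ 1) where

  full-lines : ¬ (r₀ ≡ 0 × c₀ ≡ 0)
  full-lines (refl , refl) = contradiction k≤1 (<⇒≱ (begin
    2             ≤⟨ m≤n+m 2 (x + y + q) ⟩
    x + y + q + 2 ≤⟨ light ⟩
    k + 0         ≡⟨ +-identityʳ k ⟩
    k             ∎))
    where open ≤-Reasoning

  -- Here `light` gives `x + y + q ≤ 2`, and the sum of `rows` and `cols` with the two branch bounds
  -- gives `n + m ≤ 2 + 4 * (x + y + q)`.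
  both-empty : r₀ ≡ 1 → c₀ ≡ 1 → k ≡ 0 → r₂ ≤ x + q → c₂ ≤ y + q → n + m ≤ 10
  both-empty refl refl refl r₂≤ c₂≤ = +-cancelʳ-≤ (q + q) _ _ (begin
    n + m + (q + q)                           ≡⟨ pair n m q ⟩
    (n + q) + (m + q)                         ≡⟨ cong₂ _+_ rows cols ⟩
    1 + (c₂ + c₂ + y + 0) + r₂ + (1 + (r₂ + r₂ + x + 0) + c₂)
                                              ≡⟨ collect r₂ c₂ x y ⟩
    2 + (3 * (r₂ + c₂) + (x + y))             ≤⟨ +-monoʳ-≤ 2 (+-monoˡ-≤ (x + y) (*-monoʳ-≤ 3 (+-mono-≤ r₂≤ c₂≤))) ⟩
    2 + (3 * (x + q + (y + q)) + (x + y))     ≡⟨ collect′ x y q ⟩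
    2 + 4 * (x + y + q) + (q + q)             ≤⟨ +-monoˡ-≤ (q + q) (+-monoʳ-≤ 2 (*-monoʳ-≤ 4 (+-cancelʳ-≤ 2 (x + y + q) 2 light))) ⟩
    10 + (q + q)                              ∎)
    where
    open ≤-Reasoning
    pair : ∀ n m q → n + m + (q + q) ≡ (n + q) + (m + q)
    pair = solve-∀
    collect : ∀ r₂ c₂ x y → 1 + (c₂ + c₂ + y + 0) + r₂ + (1 + (r₂ + r₂ + x + 0) + c₂)
                            ≡ 2 + (3 * (r₂ + c₂) + (x + y))
    collect = solve-∀
    collect′ : ∀ x y q → 2 + (3 * (x + q + (y + q)) + (x + y)) ≡ 2 + 4 * (x + y + q) + (q + q)
    collect′ = solve-∀

  module _ (r₀+c₀≡1 : r₀ + c₀ ≡ 1) where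
    D≤k : x + y + q ≤ k
    D≤k = +-cancelʳ-≤ 2 _ _ (subst (λ z → x + y + q + 2 ≤ k + 2 * z) r₀+c₀≡1 light)

  -- Now `x + y + q ≤ k ≤ 1`. Comparing `rows` with `cols` through `n ≤ m` also bounds `c₂ + y`, so
  -- every term of `n` is small.
  empty-row-only : r₀ ≡ 1 → c₀ ≡ 0 → r₂ ≤ x + q → n ≤ m → n ≤ 5
  empty-row-only refl refl r₂≤ n≤m = ≤-pred (+-cancelʳ-≤ q _ _ (begin
    -- The additional successor lets both copies of `c₂` use a strict bound.
    suc n + q                                      ≡⟨ cong suc rows ⟩
    suc (1 + (c₂ + c₂ + y + k) + r₂)               ≡⟨ regroup c₂ y k r₂ ⟩
    suc (c₂ + y) + (suc c₂ + (k + r₂))             ≤⟨ +-mono-≤ c₂+y< (+-mono-≤ c₂< (+-monoʳ-≤ k r₂≤)) ⟩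
    x + q + x + (x + q + x + (k + (x + q)))        ≡⟨ regroup′ x q k ⟩
    3 * x + 2 * (x + q) + k + q                    ≤⟨ +-monoˡ-≤ q (+-mono-≤ (+-mono-≤ (*-monoʳ-≤ 3 x≤1) (*-monoʳ-≤ 2 x+q≤1)) k≤1) ⟩
    6 + q                                          ∎))
    where
    open ≤-Reasoning
    D≤1 : x + y + q ≤ 1
    D≤1 = ≤-trans (D≤k refl) k≤1
    x≤1 : x ≤ 1
    x≤1 = ≤-trans (m≤m+n x y) (≤-trans (m≤m+n (x + y) q) D≤1)
    x+q≤1 : x + q ≤ 1
    x+q≤1 = ≤-trans (+-monoˡ-≤ q (m≤m+n x y)) D≤1
    regroup : ∀ c₂ y k r₂ → suc (1 + (c₂ + c₂ + y + k) + r₂) ≡ suc (c₂ + y) + (suc c₂ + (k + r₂))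
    regroup = solve-∀
    regroup′ : ∀ x q k → x + q + x + (x + q + x + (k + (x + q))) ≡ 3 * x + 2 * (x + q) + k + q
    regroup′ = solve-∀
    left : ∀ c₂ y k r₂ → 1 + (c₂ + c₂ + y + k) + r₂ ≡ suc (c₂ + y) + (c₂ + k + r₂)
    left = solve-∀
    right : ∀ c₂ x k r₂ → r₂ + r₂ + x + k + c₂ ≡ r₂ + x + (c₂ + k + r₂)
    right = solve-∀
    c₂+y< : suc (c₂ + y) ≤ x + q + x
    c₂+y< = ≤-trans (+-cancelʳ-≤ (c₂ + k + r₂) _ _ (begin
      suc (c₂ + y) + (c₂ + k + r₂)     ≡⟨ left c₂ y k r₂ ⟨
      1 + (c₂ + c₂ + y + k) + r₂       ≡⟨ rows ⟨
      n + q                            ≤⟨ +-monoˡ-≤ q n≤m ⟩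
      m + q                            ≡⟨ cols ⟩
      r₂ + r₂ + x + k + c₂             ≡⟨ right c₂ x k r₂ ⟩
      r₂ + x + (c₂ + k + r₂)           ∎)) (+-monoˡ-≤ x r₂≤)
    c₂< : suc c₂ ≤ x + q + x
    c₂< = ≤-trans (s≤s (m≤m+n c₂ y)) c₂+y<

  -- Again `x + y + q ≤ k ≤ 1`. If `y` and `q` vanish then so does `c₂`, against `bound`; `q ≡ 1`
  -- would be a path with three edges. So `y ≡ 1`, which determines everything except `r₂`.
  empty-col-only : r₀ ≡ 0 → c₀ ≡ 1 → c₂ ≤ y + q → (c₂ ≡ 0 → y ≡ 0) →
                   (x ≡ 0 → y ≡ 0 → q ≢ 1) → m + 2 ≤ 2 * n → m + 5 ≡ 2 * n
  empty-col-only refl refl c₂≤ c₂≡0⇒y≡0 no-path m+2≤2n =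
    -- The module parameters are passed as arguments so that they can be split.
    cases x y q c₂ k (D≤k refl) k≤1 c₂≤ c₂≡0⇒y≡0 no-path rows cols bound
    where
    open ≤-Reasoning
    left : ∀ x q c₂ k r₂ → 3 + x + q + (r₂ + r₂ + k + c₂) ≡ 1 + (r₂ + r₂ + x + k) + c₂ + 2 + q
    left = solve-∀
    mid : ∀ m q → m + q + 2 + q ≡ m + 2 + (q + q)
    mid = solve-∀
    mid′ : ∀ n q → 2 * n + (q + q) ≡ 2 * (n + q)
    mid′ = solve-∀
    right : ∀ y c₂ k r₂ → 2 * (c₂ + c₂ + y + k + r₂) ≡ 3 * c₂ + 2 * y + k + (r₂ + r₂ + k + c₂)
    right = solve-∀
    bound : 3 + x + q ≤ 3 * c₂ + 2 * y + k
    bound = +-cancelʳ-≤ (r₂ + r₂ + k + c₂) _ _ (begin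
      3 + x + q + (r₂ + r₂ + k + c₂)                ≡⟨ left x q c₂ k r₂ ⟩
      1 + (r₂ + r₂ + x + k) + c₂ + 2 + q            ≡⟨ cong (λ z → z + 2 + q) cols ⟨
      m + q + 2 + q                                 ≡⟨ mid m q ⟩
      m + 2 + (q + q)                               ≤⟨ +-monoˡ-≤ (q + q) m+2≤2n ⟩
      2 * n + (q + q)                               ≡⟨ mid′ n q ⟩
      2 * (n + q)                                   ≡⟨ cong (2 *_) rows ⟩
      2 * (c₂ + c₂ + y + k + r₂)                    ≡⟨ right y c₂ k r₂ ⟩
      3 * c₂ + 2 * y + k + (r₂ + r₂ + k + c₂)       ∎)
    total : ∀ r₂ → 1 + (r₂ + r₂ + 0 + 1) + 1 + 5 ≡ 2 * (4 + r₂)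
    total = solve-∀
    cases : ∀ x y q c₂ k → x + y + q ≤ k → k ≤ 1 → c₂ ≤ y + q → (c₂ ≡ 0 → y ≡ 0) →
            (x ≡ 0 → y ≡ 0 → q ≢ 1) → n + q ≡ c₂ + c₂ + y + k + r₂ →
            m + q ≡ 1 + (r₂ + r₂ + x + k) + c₂ → 3 + x + q ≤ 3 * c₂ + 2 * y + k → m + 5 ≡ 2 * n
    cases 0 0 0 _ _ _ (s≤s z≤n) z≤n _ _ _ _ (s≤s ())
    cases 0 0 1 _ _ _ _ _ _ no-path _ _ _ = contradiction refl (no-path refl refl)
    cases 0 0 (suc (suc _)) _ _ (s≤s ()) (s≤s z≤n) _ _ _ _ _ _
    cases 0 1 0 0 _ _ _ _ c₂≡0⇒y≡0 _ _ _ _ = case c₂≡0⇒y≡0 refl of λ ()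
    -- The surviving case: one empty column, one column of degree three as the only branch column,
    -- and one isolated edge. Then `n` is `4 + r₂` and `m` is `3 + 2 * r₂`.
    cases 0 1 0 1 1 _ _ _ _ _ n≡ m≡ _ = E.begin
      m + 5                           E.≡⟨ cong (_+ 5) (trans (sym (+-identityʳ m)) m≡) ⟩
      1 + (r₂ + r₂ + 0 + 1) + 1 + 5   E.≡⟨ total r₂ ⟩
      2 * (4 + r₂)                    E.≡⟨ cong (2 *_) (trans (sym (+-identityʳ n)) n≡) ⟨
      2 * n                           E.∎
      where module E = ≡-Reasoning
    cases 0 1 0 _ (suc (suc _)) _ (s≤s ()) _ _ _ _ _ _
    cases 0 1 0 (suc (suc _)) _ _ _ (s≤s ()) _ _ _ _ _
    cases 0 1 (suc _) _ _ (s≤s ()) (s≤s z≤n) _ _ _ _ _ _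
    cases 0 (suc (suc _)) _ _ _ (s≤s ()) (s≤s z≤n) _ _ _ _ _ _
    cases (suc _) 0 0 _ _ _ (s≤s z≤n) z≤n _ _ _ _ (s≤s ())
    cases 1 (suc _) _ _ _ (s≤s ()) (s≤s z≤n) _ _ _ _ _ _
    cases 1 0 (suc _) _ _ (s≤s ()) (s≤s z≤n) _ _ _ _ _ _
    cases (suc (suc _)) _ _ _ _ (s≤s ()) (s≤s z≤n) _ _ _ _ _ _

-- The lower bound

-- Two empty rows would give `(i , zero)` and `(k , zero)` the same trace, and dually for columns;
-- the sizes are successors to provide `zero`. A block gives `(i , j)` and `(k , l)` the same trace.
IDCode⇒Separated : {xs : List (Fin (suc n) × Fin (suc m))} (f : Matrix (suc n) (suc m)) →
  (∀ {i j} → (i , j) ∈ xs → f i j ≡ true) → (∀ {i j} → f i j ≡ true → (i , j) ∈ xs) →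
  IsIDCode (K (suc n) ×ᴳ K (suc m)) (_∈ xs) → Separated f
IDCode⇒Separated {xs = xs} f ∈⇒f f⇒∈ (_ , separates) = record
  { empty-row-unique = λ {i} {k} fi fk → decidable-stable (i ≟ k) λ i≢k →
      separates (i , zero) (k , zero) (i≢k ∘ cong proj₁)
        ((λ p → same-row fi fk p , proj₂ p) , (λ p → same-row fk fi p , proj₂ p))
  ; empty-col-unique = λ {j} {l} fj fl → decidable-stable (j ≟ l) λ j≢l →
      separates (zero , j) (zero , l) (j≢l ∘ cong proj₂)
        ((λ p → same-col fj fl p , proj₂ p) , (λ p → same-col fl fj p , proj₂ p))
  ; no-block = λ {i} {k} {j} {l} i≢k j≢l b → separates (i , j) (k , l) (i≢k ∘ cong proj₁)
      ( (λ p → in-block i≢k j≢l (proj₂ (proj₁ b)) (proj₂ (proj₂ b)) p , proj₂ p)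
      , (λ p → in-block (i≢k ∘ sym) (j≢l ∘ sym) (λ r → Sum.swap ∘ proj₁ (proj₁ b) r)
                        (λ r → Sum.swap ∘ proj₁ (proj₂ b) r) p , proj₂ p))
  }
  where
  G = K _ ×ᴳ K _
  same-row : ∀ {i k j p} → (∀ r → f i r ≢ true) → (∀ r → f k r ≢ true) →
             (N[_] G (i , j) ∩ (_∈ xs)) p → N[_] G (k , j) p
  same-row fi fk (inj₁ refl , p∈xs) = contradiction (∈⇒f p∈xs) (fi _)
  same-row fi fk (inj₂ (_ , j≢) , p∈xs) = inj₂ ((λ { refl → fk _ (∈⇒f p∈xs) }) , j≢)
  same-col : ∀ {i j l p} → (∀ r → f r j ≢ true) → (∀ r → f r l ≢ true) →
             (N[_] G (i , j) ∩ (_∈ xs)) p → N[_] G (i , l) p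
  same-col fj fl (inj₁ refl , p∈xs) = contradiction (∈⇒f p∈xs) (fj _)
  same-col fj fl (inj₂ (i≢ , _) , p∈xs) = inj₂ (i≢ , (λ { refl → fl _ (∈⇒f p∈xs) }))
  in-block : ∀ {i k j l p} → i ≢ k → j ≢ l → Within (f k) j l → Within (flip f l) i k →
             (N[_] G (i , j) ∩ (_∈ xs)) p → N[_] G (k , l) p
  in-block i≢k j≢l fk fl (inj₁ refl , _) = inj₂ (i≢k ∘ sym , j≢l ∘ sym)
  in-block {k = k} {l = l} {p = a , b} i≢k j≢l fk fl (inj₂ (i≢a , j≢b) , p∈xs) with k ≟ a | l ≟ b
  ... | no k≢a | no l≢b = inj₂ (k≢a , l≢b)
  -- A codeword in row `k` outside column `j` can only be `(k , l)` itself.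
  ... | yes refl | _ with fk b (∈⇒f p∈xs)
  ...   | inj₁ b≡j = contradiction (sym b≡j) j≢b
  ...   | inj₂ refl = inj₁ refl
  in-block {k = k} {p = a , b} i≢k j≢l fk fl (inj₂ (i≢a , j≢b) , p∈xs) | no _ | yes refl with fl a (∈⇒f p∈xs)
  ...   | inj₁ a≡i = contradiction (sym a≡i) i≢a
  ...   | inj₂ refl = inj₁ refl

-- Incidence matrices of lists

_≟ᶜ_ : (c d : Fin n × Fin m) → Dec (c ≡ d)
_≟ᶜ_ = ≡-dec _≟_ _≟_

module _ {n m : ℕ} where
  open DecMembership (_≟ᶜ_ {n} {m}) using (_∈?_)

  incidence : List (Fin n × Fin m) → Matrix n m
  incidence xs i j = does ((i , j) ∈? xs)

  ∈⇒incidence : ∀ xs {i j} → (i , j) ∈ xs → incidence xs i j ≡ true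
  ∈⇒incidence xs {i} {j} ij∈xs with (i , j) ∈? xs
  ... | yes _     = refl
  ... | no ij∉xs = contradiction ij∈xs ij∉xs

  incidence⇒∈ : ∀ xs {i j} → incidence xs i j ≡ true → (i , j) ∈ xs
  incidence⇒∈ xs {i} {j} eq with (i , j) ∈? xs
  ... | yes ij∈xs = ij∈xs

  -- Each further list element occupies a single position, so it adds at most one edge.
  edges≤length : ∀ xs → edges (incidence xs) ≤ length xs
  edges≤length [] = ≤-reflexive (∑-zero (row (incidence [])) (λ i → ∑-zero {m} (λ j → 0) (λ j → refl)))
  edges≤length (x ∷ xs) = begin
    ∑[ i < n ] ∑[ j < m ] ⟦ incidence (x ∷ xs) i j ⟧
      ≤⟨ ∑-mono (λ i → ∑-mono (λ j → head+tail i j)) ⟩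
    ∑[ i < n ] ∑[ j < m ] (at-head i j + ⟦ incidence xs i j ⟧)
      ≡⟨ sum-cong-≗ (λ i → ∑-distrib-+ (at-head i) (λ j → ⟦ incidence xs i j ⟧)) ⟩
    ∑[ i < n ] (sum (at-head i) + row (incidence xs) i)
      ≡⟨ ∑-distrib-+ (sum ∘ at-head) (row (incidence xs)) ⟩
    ∑[ i < n ] sum (at-head i) + edges (incidence xs)
      ≤⟨ +-mono-≤ (∑∑≤1 at-head (λ i j → ⟦⟧≤1 _) (λ p q → unique p q)) (edges≤length xs) ⟩
    suc (length xs) ∎
    where
    open ≤-Reasoning
    at-head : Fin n → Fin m → ℕ
    at-head i j = ⟦ does ((i , j) ≟ᶜ x) ⟧
    head+tail : ∀ i j → ⟦ incidence (x ∷ xs) i j ⟧ ≤ at-head i j + ⟦ incidence xs i j ⟧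
    head+tail i j with (i , j) ≟ᶜ x
    ... | yes _ = s≤s z≤n
    ... | no _  = ≤-refl
    unique : ∀ {i j k l} → 0 < at-head i j → 0 < at-head k l → i ≡ k × j ≡ l
    unique {i} {j} {k} {l} p q with (i , j) ≟ᶜ x | (k , l) ≟ᶜ x
    ... | yes refl | yes refl = refl , refl

-- The bound on the number of edges

separated⇒many-edges : {f : Matrix n m} → Separated f →
  6 ≤ n → n ≤ m → m + 2 ≤ 2 * n → m + 5 ≢ 2 * n → 2 * (n + m) < 3 * edges f + 2
separated⇒many-edges {n} {m} {f} s 6≤n n≤m m+2≤2n m+5≢2n = ≰⇒> absurd
  where
  fᵗ = flip f
  sᵗ = flip-separated s
  edges≡ : edges f ≡ leaves fᵗ + branches fᵗ + branches fᵗ + excess fᵗ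
  edges≡ = trans (edges-flip f) (edge-count fᵗ)

  module counts = LineCounts
    {r₀ = empties f} {leaves f} {branches f} {empties fᵗ} {leaves fᵗ} {branches fᵗ}
    {excess f} {excess fᵗ} {inner f} {isolated f}
    (row-count f) (row-count fᵗ) (edge-count f) edges≡ (leaf-count f)
  -- The transposed instance yields the formula for `m` as its `row-total`.
  module countsᵗ = LineCounts
    {r₀ = empties fᵗ} {leaves fᵗ} {branches fᵗ} {empties f} {leaves f} {branches f}
    {excess fᵗ} {excess f} {inner f} {isolated f}
    (row-count fᵗ) (row-count f) edges≡ (edge-count f)
    (trans (leaf-count f) (cong (_+ inner f) (+-comm (leaves f) (leaves fᵗ))))

  rows : n + inner f ≡ empties f + (branches fᵗ + branches fᵗ + excess fᵗ + isolated f) + branches f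
  rows = counts.row-total
  cols : m + inner f ≡ empties fᵗ + (branches f + branches f + excess f + isolated f) + branches fᵗ
  cols = countsᵗ.row-total

  b≤ : 0 < empties f → branches f ≤ excess f + inner f
  b≤ = branches≤ s
  bᵗ≤ : 0 < empties fᵗ → branches fᵗ ≤ excess fᵗ + inner f
  bᵗ≤ p = subst (λ q → branches fᵗ ≤ excess fᵗ + q) (inner-flip f) (branches≤ sᵗ p)

  absurd : ¬ 3 * edges f + 2 ≤ 2 * (n + m)
  absurd few = cases (empties≤1 s) (empties≤1 sᵗ)
    where
    light : excess f + excess fᵗ + inner f + 2 ≤ isolated f + 2 * (empties f + empties fᵗ)
    light = +-cancelˡ-≤ (3 * edges f) _ _ (begin
      3 * edges f + (D + 2)       ≡⟨ regroup (3 * edges f) D ⟩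
      3 * edges f + 2 + D         ≤⟨ +-monoˡ-≤ D few ⟩
      2 * (n + m) + D             ≡⟨ counts.weight ⟨
      3 * edges f + (isolated f + 2 * (empties f + empties fᵗ)) ∎)
      where
      open ≤-Reasoning
      D = excess f + excess fᵗ + inner f
      regroup : ∀ e d → e + (d + 2) ≡ e + 2 + d
      regroup = solve-∀

    open Light {r₀ = empties f} {c₀ = empties fᵗ} {r₂ = branches f} {c₂ = branches fᵗ}
               {x = excess f} {y = excess fᵗ} {q = inner f} rows cols light (isolated≤1 s)

    zero-or-one : ∀ {a} → a ≤ 1 → a ≡ 0 ⊎ a ≡ 1
    zero-or-one z≤n       = inj₁ refl
    zero-or-one (s≤s z≤n) = inj₂ refl

    pos : ∀ {a} → a ≡ 1 → 0 < a
    pos a≡1 = ≤-reflexive (sym a≡1)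

    cases : empties f ≤ 1 → empties fᵗ ≤ 1 → _
    cases p q with zero-or-one p | zero-or-one q
    ... | inj₁ r₀ | inj₁ c₀ = full-lines (r₀ , c₀)
    ... | inj₁ r₀ | inj₂ c₀ = m+5≢2n (empty-col-only r₀ c₀ (bᵗ≤ (pos c₀))
                                (branches≡0⇒excess≡0 fᵗ) (no-path s) m+2≤2n)
    ... | inj₂ r₀ | inj₁ c₀ = <⇒≱ 6≤n (empty-row-only r₀ c₀ (b≤ (pos r₀)) n≤m)
    -- From `6 ≤ n ≤ m` follows `12 ≤ n + m`, more than the ten that are allowed.
    ... | inj₂ r₀ | inj₂ c₀ = <⇒≱ (≤-trans (n≤1+n 11) (+-mono-≤ 6≤n (≤-trans 6≤n n≤m)))
      (both-empty r₀ c₀ (not-all-degenerate s (pos r₀) (pos c₀)) (b≤ (pos r₀)) (bᵗ≤ (pos c₀)))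

-- The upper bound

private variable
  k : ℕ

-- A spanning star forest without isolated edges, of at least k components.
record StarForest (k : ℕ) (E : REL (Fin n) (Fin m) 0ℓ) : Set where
  field
    rows-covered : ∀ i → ∃[ j ] E i j
    cols-covered : ∀ j → ∃[ i ] E i j
    star : ∀ {i j} → E i j →
        (∃[ l ] l ≢ j × E i l × (∀ h → E h j → h ≡ i))
      ⊎ (∃[ h ] h ≢ i × E h j × (∀ l → E i l → l ≡ j))
    matchRow : Fin k → Fin n
    matchCol : Fin k → Fin m
    match    : ∀ t → E (matchRow t) (matchCol t)
    matchRow-injective : Injective _≡_ _≡_ matchRow
    matchCol-injective : Injective _≡_ _≡_ matchCol

open StarForest

flip-forest : {E : REL (Fin n) (Fin m) 0ℓ} → StarForest k E → StarForest k (flip E)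
flip-forest F = record
  { rows-covered = cols-covered F
  ; cols-covered = rows-covered F
  ; star = Sum.swap ∘ star F
  ; matchRow = matchCol F
  ; matchCol = matchRow F
  ; match = match F
  ; matchRow-injective = matchCol-injective F
  ; matchCol-injective = matchRow-injective F
  }

-- Building star forests from components

Edges : List (Fin n × Fin m) → REL (Fin n) (Fin m) 0ℓ
Edges xs i j = (i , j) ∈ xs

record StarCode (n m k e : ℕ) : Set where
  field
    code     : List (Fin n × Fin m)
    unique   : Unique code
    size     : length code ≡ e
    forest   : StarForest k (Edges code)

open StarCode

transpose : ∀ {e} → StarCode n m k e → StarCode m n k e
transpose {n} {m} {k} c = record
  { code   = map swap (code c)
  ; unique = Unique-map⁺ (cong swap) (unique c)
  ; size   = trans (length-map swap (code c)) (size c)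
  ; forest = record
    { rows-covered = λ j → case cols-covered F j of λ (i , ij) → i , to ij
    ; cols-covered = λ i → case rows-covered F i of λ (j , ij) → j , to ij
    ; star = λ p → case star F (from p) of λ
      { (inj₁ (l , l≢j , il , only)) → inj₂ (l , l≢j , to il , λ h q → only h (from q))
      ; (inj₂ (h , h≢i , hj , only)) → inj₁ (h , h≢i , to hj , λ l q → only l (from q)) }
    ; matchRow = matchCol F
    ; matchCol = matchRow F
    ; match = to ∘ match F
    ; matchRow-injective = matchCol-injective F
    ; matchCol-injective = matchRow-injective F
    }
  }
  where
  F = forest c
  to : ∀ {i j} → (i , j) ∈ code c → (j , i) ∈ map swap (code c)
  to = ∈-map⁺ swap
  from : ∀ {i j} → (j , i) ∈ map swap (code c) → (i , j) ∈ code c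
  from p with _ , q , refl ← ∈-map⁻ swap p = q

-- The new component is a path with two edges centred at the new row; shifting the old code keeps it
-- disjoint from the new lines.
add-row : ∀ {e} → StarCode n m k e → StarCode (1 + n) (2 + m) (1 + k) (2 + e)
add-row {n} {m} {k} c = record
  { code   = xs
  ; unique = (((λ ()) ∷ All-map⁺ (All.tabulate λ _ ())) ∷ All-map⁺ (All.tabulate λ _ ()) ∷ Unique-map⁺ shift-injective (unique c))
  ; size   = cong (λ z → 2 + z) (trans (length-map shift (code c)) (size c))
  ; forest = record
    { rows-covered = λ
      { zero    → zero , here refl
      ; (suc i) → case rows-covered F i of λ (j , ij) → suc (suc j) , old ij }
    ; cols-covered = λ
      { zero          → zero , here refl
      ; (suc zero)    → zero , there (here refl)
      ; (suc (suc j)) → case cols-covered F j of λ (i , ij) → suc i , old ij }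
    ; star = star′
    ; matchRow = λ { zero → zero ; (suc t) → suc (matchRow F t) }
    ; matchCol = λ { zero → zero ; (suc t) → suc (suc (matchCol F t)) }
    ; match = λ { zero → here refl ; (suc t) → old (match F t) }
    ; matchRow-injective = λ
      { {zero} {zero} _ → refl
      ; {suc _} {suc _} eq → cong suc (matchRow-injective F (suc-injective eq)) }
    ; matchCol-injective = λ
      { {zero} {zero} _ → refl
      ; {suc _} {suc _} eq → cong suc (matchCol-injective F (suc-injective (suc-injective eq))) }
    }
  }
  where
  F = forest c
  shift : Fin n × Fin m → Fin (1 + n) × Fin (2 + m)
  shift (i , j) = suc i , suc (suc j)
  shift-injective : Injective _≡_ _≡_ shift
  shift-injective refl = refl
  xs = (zero , zero) ∷ (zero , suc zero) ∷ map shift (code c)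
  old : ∀ {i j} → (i , j) ∈ code c → (suc i , suc (suc j)) ∈ xs
  old = there ∘ there ∘ ∈-map⁺ shift

  -- Indexing by positions lets a match on an edge determine its row and column, which settles the
  -- uniqueness claims in `star′`.
  data View : Fin (1 + n) → Fin (2 + m) → Set where
    first  : View zero zero
    second : View zero (suc zero)
    shifted : ∀ {i j} → (i , j) ∈ code c → View (suc i) (suc (suc j))

  view : ∀ {i j} → (i , j) ∈ xs → View i j
  view (here refl)         = first
  view (there (here refl)) = second
  view (there (there p)) with _ , q , refl ← ∈-map⁻ shift p = shifted q

  star′ : ∀ {i j} → Edges xs i j →
      (∃[ l ] l ≢ j × Edges xs i l × (∀ h → Edges xs h j → h ≡ i))
    ⊎ (∃[ h ] h ≢ i × Edges xs h j × (∀ l → Edges xs i l → l ≡ j))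
  star′ p with view p
  ... | first  = inj₁ (suc zero , (λ ()) , there (here refl) , λ h q → case view q of λ { first → refl })
  ... | second = inj₁ (zero , (λ ()) , here refl , λ h q → case view q of λ { second → refl })
  ... | shifted q with star F q
  ...   | inj₁ (l , l≢j , il , only) = inj₁ (suc (suc l) , (λ { refl → l≢j refl }) , old il ,
                                       λ h r → case view r of λ { (shifted hj) → cong suc (only _ hj) })
  ...   | inj₂ (h , h≢i , hj , only) = inj₂ (suc h , (λ { refl → h≢i refl }) , old hj ,
                                       λ l r → case view r of λ { (shifted il) → cong (λ x → suc (suc x)) (only _ il) })

add-col : ∀ {e} → StarCode n m k e → StarCode (2 + n) (1 + m) (1 + k) (2 + e)
add-col = transpose ∘ add-row ∘ transpose

-- The claw covers four lines and each path three, so a single claw produces `n + m ≡ 1` modulo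
-- three.
claw : StarCode 1 3 1 3
claw = record
  { code   = xs
  ; unique = ((λ ()) ∷ (λ ()) ∷ []) ∷ ((λ ()) ∷ []) ∷ [] ∷ []
  ; size   = refl
  ; forest = record
    { rows-covered = λ { zero → zero , all zero }
    ; cols-covered = λ j → zero , all j
    ; star = λ { {zero} {zero} _ → inj₁ (suc zero , (λ ()) , all _ , λ { zero _ → refl })
               ; {zero} {suc _} _ → inj₁ (zero , (λ ()) , all _ , λ { zero _ → refl }) }
    ; matchRow = λ _ → zero
    ; matchCol = λ _ → zero
    ; match = λ _ → all zero
    ; matchRow-injective = λ { {zero} {zero} _ → refl }
    ; matchCol-injective = λ { {zero} {zero} _ → refl }
    }
  }
  where
  xs : List (Fin 1 × Fin 3)
  xs = (zero , zero) ∷ (zero , suc zero) ∷ (zero , suc (suc zero)) ∷ []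
  all : ∀ j → (zero , j) ∈ xs
  all zero             = here refl
  all (suc zero)       = there (here refl)
  all (suc (suc zero)) = there (there (here refl))

add-rows : ∀ a {e} → StarCode n m k e → StarCode (a + n) (a * 2 + m) (a + k) (a * 2 + e)
add-rows zero    c = c
add-rows (suc a) c = add-row (add-rows a c)

add-cols : ∀ b {e} → StarCode n m k e → StarCode (b * 2 + n) (b + m) (b + k) (b * 2 + e)
add-cols zero    c = c
add-cols (suc b) c = add-col (add-cols b c)

-- Star forests are identifying codes

module _ {E : REL (Fin n) (Fin m) 0ℓ} (F : StarForest k E) where

  -- The two neighbours `r` and `s` of row `i` exhaust `j` and `l`. The covered row `k` must then
  -- share one of them with `i`, but the neighbours of a branch row are leaves.
  branch-row-no-block : ∀ {i k j l r s} → i ≢ k → (∀ r → E k r → r ≡ j ⊎ r ≡ l) →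
    r ≡ j ⊎ r ≡ l → s ≡ j ⊎ s ≡ l → r ≢ s → ¬ (E i r × E i s)
  branch-row-no-block {i} {k} {j} {l} {r} {s} i≢k block r∈ s∈ r≢s (ir , is)
    with t , kt ← rows-covered F k = case choose (block t kt) r∈ s∈ of λ
      { (inj₁ refl) → shared ir is r≢s kt
      ; (inj₂ refl) → shared is ir (r≢s ∘ sym) kt }
    where
    shared : ∀ {r s} → E i r → E i s → r ≢ s → ¬ E k r
    shared ir is r≢s kr with star F ir
    ... | inj₁ (_ , _ , _ , only) = i≢k (sym (only _ kr))
    ... | inj₂ (_ , _ , _ , only) = r≢s (sym (only _ is))
    choose : ∀ {t} → t ≡ j ⊎ t ≡ l → r ≡ j ⊎ r ≡ l → s ≡ j ⊎ s ≡ l → t ≡ r ⊎ t ≡ s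
    choose (inj₁ refl) (inj₁ refl) _           = inj₁ refl
    choose (inj₁ refl) (inj₂ refl) (inj₁ refl) = inj₂ refl
    choose (inj₂ refl) (inj₂ refl) _           = inj₁ refl
    choose (inj₂ refl) (inj₁ refl) (inj₂ refl) = inj₂ refl
    choose _ (inj₁ refl) (inj₁ refl) = contradiction refl r≢s
    choose _ (inj₂ refl) (inj₂ refl) = contradiction refl r≢s

module _ {E : REL (Fin n) (Fin m) 0ℓ} (F : StarForest k E) where

  -- An edge at row `i` lies in a star centred either at `i` or at one of the columns `j`, `l`; the
  -- two cases are dual.
  forest-no-block : ∀ {i k j l} → i ≢ k → j ≢ l →
    (∀ r → E i r → r ≡ j ⊎ r ≡ l) → (∀ r → E k r → r ≡ j ⊎ r ≡ l) →
    (∀ r → E r j → r ≡ i ⊎ r ≡ k) → ¬ (∀ r → E r l → r ≡ i ⊎ r ≡ k)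
  forest-no-block {i} i≢k j≢l bi bk bj bl with r , ir ← rows-covered F i with star F ir
  ... | inj₁ (s , s≢r , is , _) =
          branch-row-no-block F i≢k bk (bi r ir) (bi s is) (s≢r ∘ sym) (ir , is)
  ... | inj₂ (h , h≢i , hr , _) with bi r ir
  ...   | inj₁ refl = branch-row-no-block (flip-forest F) j≢l bl (inj₁ refl) (bj h hr) (h≢i ∘ sym) (ir , hr)
  ...   | inj₂ refl = branch-row-no-block (flip-forest F) (j≢l ∘ sym) bj (inj₁ refl) (bl h hr) (h≢i ∘ sym) (ir , hr)

-- Of three pairwise disjoint edges, at most one meets row i and at most one
-- meets column j.
avoiding-edge : {E : REL (Fin n) (Fin m) 0ℓ} → StarForest (3 + k) E →
                ∀ i j → ∃[ h ] ∃[ l ] E h l × i ≢ h × j ≢ l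
avoiding-edge {k = k} {E = E} F i j = search (classify zero) (classify (suc zero)) (classify (suc (suc zero)))
  where
  Meets : Fin (3 + k) → Set
  Meets t = i ≡ matchRow F t ⊎ j ≡ matchCol F t
  Avoids : Fin (3 + k) → Set
  Avoids t = i ≢ matchRow F t × j ≢ matchCol F t
  classify : ∀ t → Avoids t ⊎ Meets t
  classify t with i ≟ matchRow F t | j ≟ matchCol F t
  ... | yes p | _     = inj₂ (inj₁ p)
  ... | no _  | yes p = inj₂ (inj₂ p)
  ... | no p  | no q  = inj₁ (p , q)
  row! : ∀ {s t} → i ≡ matchRow F s → i ≡ matchRow F t → s ≡ t
  row! p q = matchRow-injective F (trans (sym p) q)
  col! : ∀ {s t} → j ≡ matchCol F s → j ≡ matchCol F t → s ≡ t
  col! p q = matchCol-injective F (trans (sym p) q)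
  Goal = ∃[ h ] ∃[ l ] E h l × i ≢ h × j ≢ l
  found : ∀ {t} → Avoids t → Goal
  found {t} p = matchRow F t , matchCol F t , match F t , p
  search : Avoids zero ⊎ Meets zero → Avoids (suc zero) ⊎ Meets (suc zero) →
           Avoids (suc (suc zero)) ⊎ Meets (suc (suc zero)) → Goal
  search (inj₁ p) _ _ = found p
  search _ (inj₁ p) _ = found p
  search _ _ (inj₁ p) = found p
  search (inj₂ (inj₁ p)) (inj₂ (inj₁ q)) _ = case row! p q of λ ()
  search (inj₂ (inj₂ p)) (inj₂ (inj₂ q)) _ = case col! p q of λ ()
  search (inj₂ (inj₁ p)) _ (inj₂ (inj₁ q)) = case row! p q of λ ()
  search (inj₂ (inj₂ p)) _ (inj₂ (inj₂ q)) = case col! p q of λ ()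
  search _ (inj₂ (inj₁ p)) (inj₂ (inj₁ q)) = case row! p q of λ ()
  search _ (inj₂ (inj₂ p)) (inj₂ (inj₂ q)) = case col! p q of λ ()

-- Three disjoint edges suffice for domination. If two vertices have equal traces, then on a common
-- line one of them is forced into the code without being a neighbour of the other, and on no common
-- line they give a block.
starForest⇒IDCode : (xs : List (Fin n × Fin m)) → StarForest (3 + k) (Edges xs) →
                    IsIDCode (K n ×ᴳ K m) (_∈ xs)
starForest⇒IDCode {n} {m} xs F = dominating , separating
  where
  G = K n ×ᴳ K m
  Trace : Fin n × Fin m → Fin n × Fin m → Set
  Trace x = N[_] G x ∩ (_∈ xs)
  dominating : IsDominatingSet G (_∈ xs)
  dominating (i , j) with h , l , hl , i≢h , j≢l ← avoiding-edge F i j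
    = (h , l) , inj₂ (i≢h , j≢l) , hl

  not-in-line : ∀ {i j h l} → Trace (i , j) (h , l) → h ≡ i ⊎ l ≡ j → h ≡ i × l ≡ j
  not-in-line (inj₁ refl , _) _ = refl , refl
  not-in-line (inj₂ (i≢h , _) , _) (inj₁ h≡i) = contradiction (sym h≡i) i≢h
  not-in-line (inj₂ (_ , j≢l) , _) (inj₂ l≡j) = contradiction (sym l≡j) j≢l

  -- A codeword `(i , r)` with `r ≢ l` is adjacent to `(k , l)`, so it is in the trace of `(i , j)`,
  -- where the only possible member in row `i` is `(i , j)`.
  row-within : ∀ {i k j l} → i ≢ k → (∀ {p} → Trace (k , l) p → Trace (i , j) p) →
               ∀ r → (i , r) ∈ xs → r ≡ j ⊎ r ≡ l
  row-within {l = l} i≢k k⊆i r ir with l ≟ r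
  ... | yes l≡r = inj₂ (sym l≡r)
  ... | no l≢r  = inj₁ (proj₂ (not-in-line (k⊆i (inj₂ (i≢k ∘ sym , l≢r) , ir)) (inj₁ refl)))

  col-within : ∀ {i k j l} → j ≢ l → (∀ {p} → Trace (k , l) p → Trace (i , j) p) →
               ∀ r → (r , j) ∈ xs → r ≡ i ⊎ r ≡ k
  col-within {k = k} j≢l k⊆i r rj with k ≟ r
  ... | yes k≡r = inj₂ (sym k≡r)
  ... | no k≢r  = inj₁ (proj₁ (not-in-line (k⊆i (inj₂ (k≢r , j≢l ∘ sym) , rj)) (inj₂ refl)))

  separating : ∀ x y → x ≢ y → ¬ (Trace x ≐ Trace y)
  separating (i , j) (k , l) x≢y (x⊆y , y⊆x) with i ≟ k | j ≟ l
  ... | yes refl | yes refl = x≢y refl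
  -- As `k` is `i`, both alternatives put the codeword of column `j` into row `i`: it is `(i , j)`,
  -- which is not in the neighbourhood of `(i , l)`.
  ... | yes refl | no j≢l with h , hj ← cols-covered F j with col-within j≢l y⊆x h hj
  ...   | inj₁ refl = j≢l (proj₂ (not-in-line (x⊆y (inj₁ refl , hj)) (inj₁ refl)))
  ...   | inj₂ refl = j≢l (proj₂ (not-in-line (x⊆y (inj₁ refl , hj)) (inj₁ refl)))
  separating (i , j) (k , l) x≢y (x⊆y , y⊆x) | no i≢k | yes refl
    with h , ih ← rows-covered F i with row-within i≢k y⊆x h ih
  ...   | inj₁ refl = i≢k (proj₁ (not-in-line (x⊆y (inj₁ refl , ih)) (inj₂ refl)))
  ...   | inj₂ refl = i≢k (proj₁ (not-in-line (x⊆y (inj₁ refl , ih)) (inj₂ refl)))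
  separating (i , j) (k , l) x≢y (x⊆y , y⊆x) | no i≢k | no j≢l =
    forest-no-block F i≢k j≢l
      (row-within i≢k y⊆x) (λ r → Sum.swap ∘ row-within (i≢k ∘ sym) x⊆y r)
      (col-within j≢l y⊆x) (λ r → Sum.swap ∘ col-within (j≢l ∘ sym) x⊆y r)

-- The value and the size of the construction

[2+3k]%3≡2 : ∀ k → (2 + k * 3) % 3 ≡ 2
[2+3k]%3≡2 k = [m+kn]%n≡m%n 2 k 3

[2+3k]/3≡k : ∀ k → (2 + k * 3) ℕ./ 3 ≡ k
[2+3k]/3≡k k = trans (+-distrib-/-∣ʳ 2 {d = 3} (n∣m*n k)) (m*n/n≡m k 3)

-- The remainder two is nonzero, so rounding up gives the successor of the quotient.
ceiling-[2+3k]/3 : ∀ k → ceiling (+ (2 + k * 3) / 3) ≡ + suc k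
ceiling-[2+3k]/3 k rewrite [2+3k]%3≡2 k | [2+3k]/3≡k k | +-identityʳ k = refl

-- As `2 * (n + m)` is `3 * (2 * t) + 2`, cancelling the two in the strict edge bound leaves
-- `2 * t < edges f`.
lower-bound : ∀ {n m t} → 6 ≤ n → n ≤ m → m + 2 ≤ 2 * n → m + 5 ≢ 2 * n → n + m ≡ 1 + t * 3 →
  (xs : List (Fin n × Fin m)) → IsIDCode (K n ×ᴳ K m) (_∈ xs) → suc (2 * t) ≤ length xs
lower-bound {n@(suc _)} {m@(suc _)} {t} 6≤n n≤m m+2≤2n m+5≢2n n+m≡ xs isID =
  *-cancelˡ-< 3 _ _ (<-≤-trans (+-cancelʳ-< 2 _ _ (begin-strict
    3 * (2 * t) + 2    ≡⟨ regroup t ⟩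
    2 * (1 + t * 3)    ≡⟨ cong (2 *_) n+m≡ ⟨
    2 * (n + m)        <⟨ separated⇒many-edges separated 6≤n n≤m m+2≤2n m+5≢2n ⟩
    3 * edges f + 2    ∎)) (*-monoʳ-≤ 3 (edges≤length xs)))
  where
  open ≤-Reasoning
  f = incidence xs
  separated = IDCode⇒Separated f (∈⇒incidence xs) (incidence⇒∈ xs) isID
  regroup : ∀ t → 3 * (2 * t) + 2 ≡ 2 * (1 + t * 3)
  regroup = solve-∀

reindex : ∀ {n n′ m m′ k k′ e e′} → n ≡ n′ → m ≡ m′ → k ≡ k′ → e ≡ e′ →
          StarCode n m k e → StarCode n′ m′ k′ e′
reindex refl refl refl refl c = c

-- Solving 1 + a + 2b = n and 3 + 2a + b = m gives b = n ∸ t and a = 2t ∸ (n + 1);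
-- both are positive, so there are at least three stars.
starCode : ∀ {n m t} → 6 ≤ n → n ≤ m → m + 2 ≤ 2 * n → n + m ≡ 1 + t * 3 →
           ∃[ k ] StarCode n m (3 + k) (suc (2 * t))
starCode {n} {m} {t} 6≤n n≤m m+2≤2n n+m≡ = a + b , c
  where
  open ≤-Reasoning

  -- The upper bound on `m` keeps the subtraction in `b` from truncating.
  t<n : suc t ≤ n
  t<n = *-cancelʳ-≤ (suc t) n 3 (begin
    suc t * 3             ≡⟨ regroup t ⟩
    1 + t * 3 + 2         ≡⟨ cong (_+ 2) n+m≡ ⟨
    n + m + 2             ≡⟨ +-assoc n m 2 ⟩
    n + (m + 2)           ≤⟨ +-monoʳ-≤ n m+2≤2n ⟩
    n + 2 * n             ≡⟨ triple n ⟩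
    n * 3                 ∎)
    where
    regroup : ∀ t → suc t * 3 ≡ 1 + t * 3 + 2
    regroup = solve-∀
    triple : ∀ n → n + 2 * n ≡ n * 3
    triple = solve-∀

  -- Together `6 ≤ n` and `n ≤ m` keep the subtraction in `a` from truncating.
  n+2≤2t : n + 2 ≤ 2 * t
  n+2≤2t = subst (_≤ 2 * t) (+-comm 2 n) (*-cancelˡ-< 3 (suc n) (2 * t) (+-cancelʳ-≤ 2 _ _ (begin
    suc (3 * suc n) + 2   ≡⟨ regroup n ⟩
    6 + 3 * n             ≤⟨ +-monoˡ-≤ (3 * n) 6≤n ⟩
    n + 3 * n             ≡⟨ quadruple n ⟩
    2 * (n + n)           ≤⟨ *-monoʳ-≤ 2 (+-monoʳ-≤ n n≤m) ⟩
    2 * (n + m)           ≡⟨ cong (2 *_) n+m≡ ⟩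
    2 * (1 + t * 3)       ≡⟨ regroup′ t ⟩
    3 * (2 * t) + 2       ∎)))
    where
    regroup : ∀ n → suc (3 * suc n) + 2 ≡ 6 + 3 * n
    regroup = solve-∀
    quadruple : ∀ n → n + 3 * n ≡ 2 * (n + n)
    quadruple = solve-∀
    regroup′ : ∀ t → 2 * (1 + t * 3) ≡ 3 * (2 * t) + 2
    regroup′ = solve-∀

  -- Both are one less than the number of paths of their kind: `suc a` paths centred at rows and
  -- `suc b` at columns are used, so that with the claw the count is visibly at least three.
  a b : ℕ
  a = 2 * t ∸ (n + 2)
  b = n ∸ suc t

  n≡t+b : suc t + b ≡ n
  n≡t+b = m+[n∸m]≡n t<n

  2t≡n+a : n + 2 + a ≡ 2 * t
  2t≡n+a = m+[n∸m]≡n n+2≤2t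

  t≡ : t ≡ 3 + a + b
  t≡ = +-cancelˡ-≡ t _ _ (trans (sym double) (trans (sym 2t≡n+a) (trans (cong (λ z → z + 2 + a) (sym n≡t+b)) (regroup t a b))))
    where
    double : 2 * t ≡ t + t
    double = cong (λ z → t + z) (+-identityʳ t)
    regroup : ∀ t a b → suc t + b + 2 + a ≡ t + (3 + a + b)
    regroup = solve-∀

  n≡ : suc a + (suc b * 2 + 1) ≡ n
  n≡ = trans (regroup a b) (trans (cong (λ z → suc z + b) (sym t≡)) n≡t+b)
    where
    regroup : ∀ a b → suc a + (suc b * 2 + 1) ≡ suc (3 + a + b) + b
    regroup = solve-∀

  m≡ : suc a * 2 + (suc b + 3) ≡ m
  m≡ = +-cancelˡ-≡ n _ _ (trans (cong (_+ (suc a * 2 + (suc b + 3))) (sym n≡))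
    (trans (regroup a b) (trans (cong (λ z → 1 + z * 3) (sym t≡)) (sym n+m≡))))
    where
    regroup : ∀ a b → suc a + (suc b * 2 + 1) + (suc a * 2 + (suc b + 3)) ≡ 1 + (3 + a + b) * 3
    regroup = solve-∀

  count≡ : suc a + (suc b + 1) ≡ 3 + (a + b)
  count≡ = regroup a b
    where
    regroup : ∀ a b → suc a + (suc b + 1) ≡ 3 + (a + b)
    regroup = solve-∀

  size≡ : suc a * 2 + (suc b * 2 + 3) ≡ suc (2 * t)
  size≡ = trans (regroup a b) (cong (λ z → suc (2 * z)) (sym t≡))
    where
    regroup : ∀ a b → suc a * 2 + (suc b * 2 + 3) ≡ suc (2 * (3 + a + b))
    regroup = solve-∀

  c : StarCode n m (3 + (a + b)) (suc (2 * t))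
  c = reindex n≡ m≡ count≡ size≡ (add-rows (suc a) (add-cols (suc b) claw))

theorem5 : (n m : ℕ) → 6 ≤ n → n ≤ m → m ≤ 2 * n ∸ 2 → m ≢ 2 * n ∸ 5 →
    (n + m) % 3 ≡ 1 →
    ∃[ k ] (γᴵᴰ K n ×ᴳ K m ≔ k) × (+ k ≡ ceiling (+ (2 * m + 2 * n) / 3))
theorem5 n m 6≤n n≤m m≤2n∸2 m≢2n∸5 n+m%3≡1 =
  suc (2 * t) , (minimal-code , λ xs isID → lower-bound {t = t} 6≤n n≤m m+2≤2n m+5≢2n n+m≡ xs (proj₂ isID)) , ceiling≡
  where
  -- The quotient; the sum is `1 + t * 3`, and the value is `suc (2 * t)`.
  t = (n + m) ℕ./ 3

  n+m≡ : n + m ≡ 1 + t * 3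
  n+m≡ = trans (m≡m%n+[m/n]*n (n + m) 3) (cong (_+ t * 3) n+m%3≡1)

  -- From here on sums replace the truncated subtractions; `2 ≤ 2 * n` makes the one in the bound on
  -- `m` exact.
  m+2≤2n : m + 2 ≤ 2 * n
  m+2≤2n = subst (m + 2 ≤_) (m∸n+n≡m (≤-trans 2≤6 (≤-trans 6≤n (m≤n*m n 2)))) (+-monoˡ-≤ 2 m≤2n∸2)
    where
    2≤6 : 2 ≤ 6
    2≤6 = s≤s (s≤s z≤n)

  m+5≢2n : m + 5 ≢ 2 * n
  m+5≢2n eq = m≢2n∸5 (trans (sym (m+n∸n≡m m 5)) (cong (_∸ 5) eq))

  minimal-code : ∃[ xs ] IsFiniteIDCode (K n ×ᴳ K m) xs × length xs ≡ suc (2 * t)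
  minimal-code with _ , c ← starCode {t = t} 6≤n n≤m m+2≤2n n+m≡ =
    code c , (unique c , starForest⇒IDCode (code c) (forest c)) , size c

  ceiling≡ : + suc (2 * t) ≡ ceiling (+ (2 * m + 2 * n) / 3)
  ceiling≡ = sym (trans (cong (λ z → ceiling (+ z / 3)) (begin
    2 * m + 2 * n      ≡⟨ regroup n m ⟩
    2 * (n + m)        ≡⟨ cong (2 *_) n+m≡ ⟩
    2 * (1 + t * 3)    ≡⟨ regroup′ t ⟩
    2 + 2 * t * 3      ∎)) (ceiling-[2+3k]/3 (2 * t)))
    where
    open ≡-Reasoning
    regroup : ∀ n m → 2 * m + 2 * n ≡ 2 * (n + m)
    regroup = solve-∀
    regroup′ : ∀ t → 2 * (1 + t * 3) ≡ 2 + 2 * t * 3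
    regroup′ = solve-∀
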